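{- Let $p$ be a prime. The ring $\mathbb{Z}[1/p]$ admits a 4-cycle if and only if $p=2$ or $p=3$.
   Context: A set of primes $\{p_1,\dots,p_n\}$ is said to admit a 4-cycle if there exist signs $\epsilon_1,\epsilon_2,\epsilon_3,\epsilon_4\in\{ -1,1\}$ and integers $u_i=p_1^{a_{i1}}\cdots p_n^{a_{in}}$ ($1\le i\le 4$), with every $a_{ij}$ a nonnegative integer, such that $\epsilon_1u_1+\epsilon_2u_2+\epsilon_3u_3+\epsilon_4u_4=0$ and no proper nonempty subsum vanishes (i.e. $\sum_{i\in I}\epsilon_iu_i\neq 0$ for every $\emptyset\ne I\subsetneq\{1,2,3,4\}$). The $u_i$ need not be distinct. The ring $\mathbb{Z}[1/p_1,\dots,1/p_n]$ is said to admit a 4-cycle if the set of primes $\{p_1,\dots,p_n\}$ admits a 4-cycle. -}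

module Defs where

open import Data.Bool.Base using (if_then_else_)
open import Data.Fin.Base using (Fin; zero)
open import Data.Fin.Subset using (Subset; Nonempty; _⊂_; ⊤)
open import Data.Integer.Base as ℤ using (ℤ; +_; 0ℤ; _◃_)
open import Data.Nat.Base as ℕ using (ℕ; _^_)
open import Data.Nat.Primality using (Prime)
open import Data.Product.Base using (Σ-syntax; ∃-syntax; _×_)
open import Data.Rational.Base as ℚ using (ℚ; _/_)
open import Data.Sign.Base using (Sign)
open import Data.Vec.Base using (lookup)
open import Data.Vec.Functional using (Vector; foldr)
open import Function.Definitions using (Injective)
open import Level using (0ℓ)
open import Relation.Binary.PropositionalEquality using (_≡_; _≢_; refl)
open import Relation.Unary using (Pred; _≐_)

record PrimeSet : Set where
  field
    size     : ℕ
    elem     : Fin size → ℕ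
    prime    : ∀ i → Prime (elem i)
    distinct : Injective _≡_ _≡_ elem

open PrimeSet public

singleton : (p : ℕ) → Prime p → PrimeSet
singleton p p-prime = record
  { size     = 1
  ; elem     = λ _ → p
  ; prime    = λ _ → p-prime
  ; distinct = λ { {zero} {zero} _ → refl }
  }

monomial : (P : PrimeSet) → Vector ℕ (size P) → ℕ
monomial P a = foldr ℕ._*_ 1 (λ j → elem P j ^ a j)

∑ : ∀ {n} → Vector ℤ n → ℤ
∑ = foldr ℤ._+_ 0ℤ

∑[_] : ∀ {n} → Subset n → Vector ℤ n → ℤ
∑[ I ] x = ∑ (λ i → if lookup I i then x i else 0ℤ)

-- `ε i ◃ u i` is the integer εᵢ uᵢ.
Admits4Cycle : PrimeSet → Set
Admits4Cycle P =
  Σ[ ε ∈ Vector Sign 4 ] Σ[ a ∈ Vector (Vector ℕ (size P)) 4 ]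
    let u : Vector ℕ 4
        u i = monomial P (a i)
        x : Vector ℤ 4
        x i = ε i ◃ u i
    in ∑ x ≡ 0ℤ
       × (∀ (I : Subset 4) → Nonempty I → I ⊂ ⊤ → ∑[ I ] x ≢ 0ℤ)

-- The subring ℤ[1/p₁,…,1/pₙ] of ℚ: the rationals z / m with m a monomial in
-- the pⱼ, written as q · m = z so that no nonzero-denominator proof is needed.
ℤ[1/_] : PrimeSet → Pred ℚ 0ℓ
ℤ[1/ P ] q =
  Σ[ z ∈ ℤ ] Σ[ a ∈ Vector ℕ (size P) ] q ℚ.* (+ monomial P a / 1) ≡ z / 1

-- A subring of ℚ admits a 4-cycle if it is ℤ[1/p₁,…,1/pₙ] for a set of primes
-- admitting one.  That set is determined by the ring (it consists of the primes
-- invertible in it), so the existential ranges over at most one set, up to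
-- the order of enumeration.
RingAdmits4Cycle : Pred ℚ 0ℓ → Set
RingAdmits4Cycle R = ∃[ P ] (R ≐ ℤ[1/ P ] × Admits4Cycle P)

{-# OPTIONS --safe #-}

-- The ring determines its primes: if 1/q lies in ℤ[1/p] then q divides a power
-- of p, so q = p.  Hence a 4-cycle consists of terms ±p^kᵢ.  Take the terms
-- with minimal exponent m.  Modulo p^(m+1) only these contribute, so p divides
-- the sum of their signs; if p > 4 that sum is zero and the terms of exponent m
-- form a vanishing subsum.  If these are all four terms, two of them are
-- opposite and already cancel.  For p = 2 and p = 3 there are the cycles
-- 1 + 1 + 2 - 4 and 1 + 1 + 1 - 3.
module Submission where

open import Data.Fin.Base using (Fin; zero; suc)
open import Data.Fin.Patterns using (0F; 1F; 2F; 3F)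
open import Data.Fin.Properties using (all?; ¬∀⟶∃¬)
open import Data.Fin.Subset using (Subset; Nonempty; _⊂_; ⊤; inside; outside)
open import Data.Fin.Subset.Properties using (anySubset?; nonempty?; _⊂?_; ⊆⊤; ∈⊤)
open import Data.Integer.Base as ℤ using (ℤ; +_; 0ℤ; 1ℤ; _◃_; ∣_∣)
import Data.Integer.Properties as ℤ
open import Data.Integer.Tactic.RingSolver using (solve-∀)
open import Data.List.Base using (allFin)
open import Data.List.Extrema.Nat using (argmin; f[argmin]≤f[xs])
open import Data.List.Membership.Propositional.Properties using (∈-allFin)
import Data.List.Relation.Unary.All as All
open import Data.Nat using (ℕ)
open import Data.Nat.Base as ℕ using (zero; suc; _^_; _≤_; _<_; z≤n)
open import Data.Nat.Divisibility
  using (_∣_; divides; ∣-refl; ∣m⇒∣m*n; ∣n⇒∣m*n; ∣⇒≤; ∣1⇒≡1)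
open import Data.Nat.Primality
  using (Prime; prime⇒irreducible; euclidsLemma; ¬prime[0]; ¬prime[1]; composite[4]; composite⇒¬prime)
import Data.Nat.Properties as ℕ
open import Data.Product.Base using (∃₂; ∃-syntax; _×_; _,_; proj₁; proj₂)
open import Data.Rational.Base as ℚ using (_/_; toℚᵘ)
import Data.Rational.Properties as ℚ
open import Data.Rational.Unnormalised.Base as ℚᵘ using (mkℚᵘ; *≡*)
import Data.Rational.Unnormalised.Properties as ℚᵘ
open import Data.Sign.Base as Sign using (Sign)
import Data.Sign.Properties as Sign
open import Data.Sum using (_⊎_; inj₁; inj₂)
open import Data.Vec.Base using (_∷_; []; tabulate; here; there)
open import Data.Vec.Functional using (Vector; foldr)
open import Data.Vec.Properties using (lookup∘tabulate; lookup⇒[]=; []=⇒lookup)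
open import Function.Base using (_∘_)
open import Function.Bundles using (_⇔_; mk⇔)
open import Relation.Binary.PropositionalEquality
  using (_≡_; _≢_; refl; sym; trans; cong; cong₂; subst; module ≡-Reasoning)
open import Relation.Nullary using (¬_; Dec; contradiction; does; yes; no)
open import Relation.Nullary.Decidable using (dec-true; dec-false; _×-dec_; from-no)
open import Relation.Unary using (_⊆_)
open import Defs

-- Recovering the primes from the ring.

factor∣product : ∀ {n} (f : Vector ℕ n) i → f i ∣ foldr ℕ._*_ 1 f
factor∣product f zero    = ∣m⇒∣m*n _ ∣-refl
factor∣product f (suc i) = ∣n⇒∣m*n (f zero) (factor∣product (f ∘ suc) i)

prime∣^⇒∣ : ∀ {q} m a → Prime q → q ∣ m ^ a → q ∣ m
prime∣^⇒∣ m zero    q-prime q∣1 with refl ← ∣1⇒≡1 q∣1 = contradiction q-prime ¬prime[1]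
prime∣^⇒∣ m (suc a) q-prime q∣m*mᵃ with euclidsLemma m (m ^ a) q-prime q∣m*mᵃ
... | inj₁ q∣m  = q∣m
... | inj₂ q∣mᵃ = prime∣^⇒∣ m a q-prime q∣mᵃ

prime∣prime⇒≡ : ∀ {p q} → Prime p → Prime q → q ∣ p → q ≡ p
prime∣prime⇒≡ p-prime q-prime q∣p with prime⇒irreducible p-prime q∣p
... | inj₁ refl = contradiction q-prime ¬prime[1]
... | inj₂ q≡p  = q≡p

-- Normalised fractions hide a division by a gcd. Passing to unnormalised rationals makes equality
-- plain cross-multiplication, which the next two lemmas read off in both directions.
toℚᵘ-/*/1 : ∀ a n c → toℚᵘ ((a / suc n) ℚ.* (c / 1)) ℚᵘ.≃ mkℚᵘ a n ℚᵘ.* mkℚᵘ c 0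
toℚᵘ-/*/1 a n c = ℚᵘ.≃-trans (ℚ.toℚᵘ-homo-* (a / suc n) (c / 1))
  (ℚᵘ.*-cong (ℚ.toℚᵘ-fromℚᵘ (mkℚᵘ a n)) (ℚ.toℚᵘ-fromℚᵘ (mkℚᵘ c 0)))

/*/1≡/1⇒ : ∀ a n c z → (a / suc n) ℚ.* (c / 1) ≡ z / 1 → a ℤ.* c ≡ z ℤ.* + suc n
/*/1≡/1⇒ a n c z eq
  with *≡* eq′ ← ℚᵘ.≃-trans (ℚᵘ.≃-sym (toℚᵘ-/*/1 a n c))
                   (ℚᵘ.≃-trans (ℚ.toℚᵘ-cong eq) (ℚ.toℚᵘ-fromℚᵘ (mkℚᵘ z 0)))
  = begin
  a ℤ.* c                  ≡⟨ ℤ.*-identityʳ _ ⟨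
  a ℤ.* c ℤ.* 1ℤ           ≡⟨ eq′ ⟩
  z ℤ.* + (suc n ℕ.* 1)    ≡⟨ cong (λ d → z ℤ.* + d) (ℕ.*-identityʳ (suc n)) ⟩
  z ℤ.* + suc n            ∎
  where open ≡-Reasoning

/*/1≡/1⇐ : ∀ a n c z → a ℤ.* c ≡ z ℤ.* + suc n → (a / suc n) ℚ.* (c / 1) ≡ z / 1
/*/1≡/1⇐ a n c z eq = ℚ.toℚᵘ-injective
  (ℚᵘ.≃-trans (toℚᵘ-/*/1 a n c)
    (ℚᵘ.≃-trans (*≡* eq′) (ℚᵘ.≃-sym (ℚ.toℚᵘ-fromℚᵘ (mkℚᵘ z 0)))))
  where
  open ≡-Reasoning
  eq′ : a ℤ.* c ℤ.* 1ℤ ≡ z ℤ.* + (suc n ℕ.* 1)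
  eq′ = begin
    a ℤ.* c ℤ.* 1ℤ         ≡⟨ ℤ.*-identityʳ _ ⟩
    a ℤ.* c                ≡⟨ eq ⟩
    z ℤ.* + suc n          ≡⟨ cong (λ d → z ℤ.* + d) (ℕ.*-identityʳ (suc n)) ⟨
    z ℤ.* + (suc n ℕ.* 1)  ∎

∣monomial⇒1/∈ℤ[1/] : ∀ P n a → suc n ∣ monomial P a → ℤ[1/ P ] (1ℤ / suc n)
∣monomial⇒1/∈ℤ[1/] P n a (divides r eq) =
  + r , a , /*/1≡/1⇐ 1ℤ n (+ monomial P a) (+ r) (begin
    1ℤ ℤ.* + monomial P a  ≡⟨ ℤ.*-identityˡ _ ⟩
    + monomial P a         ≡⟨ cong +_ eq ⟩
    + (r ℕ.* suc n)        ≡⟨ ℤ.pos-* r (suc n) ⟩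
    + r ℤ.* + suc n        ∎)
  where open ≡-Reasoning

1/∈ℤ[1/]⇒∣monomial : ∀ P n → ℤ[1/ P ] (1ℤ / suc n) → ∃[ a ] suc n ∣ monomial P a
1/∈ℤ[1/]⇒∣monomial P n (z , a , eq) = a , divides ∣ z ∣ (begin
  monomial P a              ≡⟨ cong ∣_∣ (ℤ.*-identityˡ (+ monomial P a)) ⟨
  ∣ 1ℤ ℤ.* + monomial P a ∣ ≡⟨ cong ∣_∣ (/*/1≡/1⇒ 1ℤ n (+ monomial P a) z eq) ⟩
  ∣ z ℤ.* + suc n ∣         ≡⟨ ℤ.abs-* z (+ suc n) ⟩
  ∣ z ∣ ℕ.* suc n           ∎)
  where open ≡-Reasoning

-- The inclusion is tested on `1ℤ / suc n`: such a fraction lies in a ring exactly when its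
-- denominator divides a monomial of that ring.
⊆⇒∣monomial : ∀ P Q → ℤ[1/ P ] ⊆ ℤ[1/ Q ] → ∀ n a → suc n ∣ monomial P a → ∃[ b ] suc n ∣ monomial Q b
⊆⇒∣monomial P Q P⊆Q n a n∣ =
  1/∈ℤ[1/]⇒∣monomial Q n (P⊆Q {1ℤ / suc n} (∣monomial⇒1/∈ℤ[1/] P n a n∣))

ℤ[1/]-elem≡ : ∀ {p} (p-prime : Prime p) P → ℤ[1/ P ] ⊆ ℤ[1/ singleton p p-prime ] →
              ∀ j → elem P j ≡ p
ℤ[1/]-elem≡ {p} p-prime P P⊆p j = go (elem P j) (prime P j)
  -- With all exponents 1 the monomial is the product of all primes of `P`, so each of them divides
  -- it.
  (subst (_∣ monomial P (λ _ → 1)) (ℕ.*-identityʳ (elem P j)) (factor∣product (λ i → elem P i ^ 1) j))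
  where
  -- Abstracting `elem P j` to `q` allows matching it as `suc n`, the shape of denominator that
  -- `⊆⇒∣monomial` expects.
  go : ∀ q → Prime q → q ∣ monomial P (λ _ → 1) → q ≡ p
  go zero    q-prime _   = contradiction q-prime ¬prime[0]
  go (suc n) q-prime q∣Π =
    let a , q∣pᵃ = ⊆⇒∣monomial P (singleton p p-prime) (λ {x} → P⊆p {x}) n (λ _ → 1) q∣Π
    in prime∣prime⇒≡ p-prime q-prime
         (prime∣^⇒∣ p (a zero) q-prime (subst (suc n ∣_) (ℕ.*-identityʳ (p ^ a zero)) q∣pᵃ))

-- Exponents add up; this reduces a cycle over `P` to a relation between powers of the single number
-- `p`.
product-of-powers : ∀ {n p} (f a : Vector ℕ n) → (∀ j → f j ≡ p) →
                    ∃[ k ] foldr ℕ._*_ 1 (λ j → f j ^ a j) ≡ p ^ k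
product-of-powers {zero}      f a f≡p = 0 , refl
product-of-powers {suc n} {p} f a f≡p
  with k , eq ← product-of-powers (f ∘ suc) (a ∘ suc) (f≡p ∘ suc)
  = a zero ℕ.+ k , trans (cong₂ ℕ._*_ (cong (_^ a zero) (f≡p zero)) eq)
                         (sym (ℕ.^-distribˡ-+-* p (a zero) k))

-- The terms of least exponent.

◃-* : ∀ s m n → s ◃ (m ℕ.* n) ≡ (s ◃ m) ℤ.* + n
◃-* s m n = begin
  s ◃ (m ℕ.* n)                 ≡⟨ cong (_◃ (m ℕ.* n)) (Sign.*-identityʳ s) ⟨
  (s Sign.* Sign.+) ◃ (m ℕ.* n) ≡⟨ ℤ.◃-distrib-* s Sign.+ m n ⟩
  (s ◃ m) ℤ.* (Sign.+ ◃ n)      ≡⟨ cong ((s ◃ m) ℤ.*_) (ℤ.+◃n≡+n n) ⟩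
  (s ◃ m) ℤ.* + n               ∎
  where open ≡-Reasoning

level : ∀ {n} → ℕ → Vector ℕ n → Subset n
level m k = tabulate (λ i → does (k i ℕ.≟ m))

-- s is the sum of the signs of the terms with exponent m.
lowest-terms : ∀ {n} p m (ε : Vector Sign n) (u k : Vector ℕ n) →
  (∀ i → u i ≡ p ^ k i) → (∀ i → m ≤ k i) →
  ∃₂ λ s t → ∣ s ∣ ≤ n
    × ∑[ level m k ] (λ i → ε i ◃ u i) ≡ s ℤ.* + (p ^ m)
    × ∑ (λ i → ε i ◃ u i) ≡ (s ℤ.+ t ℤ.* + p) ℤ.* + (p ^ m)
lowest-terms {zero}  p m ε u k u≡ m≤k = 0ℤ , 0ℤ , z≤n , refl , refl
lowest-terms {suc n} p m ε u k u≡ m≤k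
  with s , t , ∣s∣≤n , eqₗ , eq ← lowest-terms p m (ε ∘ suc) (u ∘ suc) (k ∘ suc) (u≡ ∘ suc) (m≤k ∘ suc)
  with k zero ℕ.≟ m
... | yes k≡m rewrite dec-true (k zero ℕ.≟ m) k≡m =
  e ℤ.+ s , t , bound , trans (cong₂ ℤ._+_ x₀ eqₗ) (sym (ℤ.*-distribʳ-+ (+ (p ^ m)) e s))
    , trans (cong₂ ℤ._+_ x₀ eq) (regroup e s (t ℤ.* + p) (+ (p ^ m)))
  where
  e : ℤ
  e = ε zero ◃ 1
  bound : ∣ e ℤ.+ s ∣ ≤ suc n
  bound = ℕ.≤-trans (ℤ.∣i+j∣≤∣i∣+∣j∣ e s)
                    (ℕ.+-mono-≤ (ℕ.≤-reflexive (ℤ.abs-◃ (ε zero) 1)) ∣s∣≤n)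
  x₀ : ε zero ◃ u zero ≡ e ℤ.* + (p ^ m)
  x₀ = trans (cong (ε zero ◃_) (trans (u≡ zero) (trans (cong (p ^_) k≡m) (sym (ℕ.*-identityˡ _)))))
             (◃-* (ε zero) 1 (p ^ m))
  regroup : ∀ e s w q → e ℤ.* q ℤ.+ (s ℤ.+ w) ℤ.* q ≡ (e ℤ.+ s ℤ.+ w) ℤ.* q
  regroup = solve-∀
... | no k≢m rewrite dec-false (k zero ℕ.≟ m) k≢m =
  s , e ℤ.+ t , ℕ.m≤n⇒m≤1+n ∣s∣≤n , trans (ℤ.+-identityˡ _) eqₗ
    , trans (cong₂ ℤ._+_ x₀ eq) (regroup e s t (+ p) (+ (p ^ m)))
  where
  open ≡-Reasoning
  d : ℕ
  -- Since `k zero` exceeds `m`, subtracting `suc m` rather than `m` loses nothing and leaves one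
  -- spare factor `p`, which moves this term into the coefficient `t`.
  d = k zero ℕ.∸ suc m
  e : ℤ
  e = ε zero ◃ p ^ d
  k≡ : k zero ≡ d ℕ.+ suc m
  k≡ = sym (ℕ.m∸n+n≡m (ℕ.≤∧≢⇒< (m≤k zero) (k≢m ∘ sym)))
  x₀ : ε zero ◃ u zero ≡ e ℤ.* (+ p ℤ.* + (p ^ m))
  x₀ = begin
    ε zero ◃ u zero               ≡⟨ cong (ε zero ◃_) (trans (u≡ zero) (cong (p ^_) k≡)) ⟩
    ε zero ◃ p ^ (d ℕ.+ suc m)    ≡⟨ cong (ε zero ◃_) (ℕ.^-distribˡ-+-* p d (suc m)) ⟩
    ε zero ◃ (p ^ d ℕ.* p ^ suc m) ≡⟨ ◃-* (ε zero) (p ^ d) (p ^ suc m) ⟩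
    e ℤ.* + (p ^ suc m)           ≡⟨ cong (e ℤ.*_) (ℤ.pos-* p (p ^ m)) ⟩
    e ℤ.* (+ p ℤ.* + (p ^ m))     ∎
  regroup : ∀ e s t p q → e ℤ.* (p ℤ.* q) ℤ.+ (s ℤ.+ t ℤ.* p) ℤ.* q ≡ (s ℤ.+ (e ℤ.+ t) ℤ.* p) ℤ.* q
  regroup = solve-∀

-- Cancelling `p ^ m` leaves `s` equal to a multiple of `p`, and `∣ s ∣ ≤ n < p` then forces `s` to
-- be zero.
lowest-terms-vanish : ∀ {n} p m (ε : Vector Sign n) (u k : Vector ℕ n) → n < p →
  (∀ i → u i ≡ p ^ k i) → (∀ i → m ≤ k i) →
  ∑ (λ i → ε i ◃ u i) ≡ 0ℤ → ∑[ level m k ] (λ i → ε i ◃ u i) ≡ 0ℤ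
lowest-terms-vanish {n} p@(suc _) m ε u k n<p u≡ m≤k ∑≡0
  with s , t , ∣s∣≤n , eqₗ , eq ← lowest-terms p m ε u k u≡ m≤k
  = trans eqₗ (cong (λ i → i ℤ.* + (p ^ m)) (ℤ.∣i∣≡0⇒i≡0 {s} (small ∣ s ∣ ∣s∣≤n p∣s)))
  where
  instance
    pᵐ-nonZero : ℕ.NonZero (p ^ m)
    pᵐ-nonZero = ℕ.m^n≢0 p m
  s+tp≡0 : s ℤ.+ t ℤ.* + p ≡ 0ℤ
  s+tp≡0 = ℤ.*-cancelʳ-≡ (s ℤ.+ t ℤ.* + p) 0ℤ (+ (p ^ m)) (trans (sym eq) ∑≡0)
  p∣s : p ∣ ∣ s ∣
  p∣s = divides ∣ t ∣ (begin
    ∣ s ∣                                      ≡⟨ cong ∣_∣ (regroup s (t ℤ.* + p)) ⟩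
    ∣ (s ℤ.+ t ℤ.* + p) ℤ.- t ℤ.* + p ∣        ≡⟨ cong (λ r → ∣ r ℤ.- t ℤ.* + p ∣) s+tp≡0 ⟩
    ∣ 0ℤ ℤ.- t ℤ.* + p ∣                       ≡⟨ cong ∣_∣ (ℤ.+-identityˡ (ℤ.- (t ℤ.* + p))) ⟩
    ∣ ℤ.- (t ℤ.* + p) ∣                        ≡⟨ ℤ.∣-i∣≡∣i∣ (t ℤ.* + p) ⟩
    ∣ t ℤ.* + p ∣                              ≡⟨ ℤ.abs-* t (+ p) ⟩
    ∣ t ∣ ℕ.* p                                ∎)
    where
    open ≡-Reasoning
    regroup : ∀ s w → s ≡ (s ℤ.+ w) ℤ.- w
    regroup = solve-∀
  small : ∀ r → r ≤ n → p ∣ r → r ≡ 0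
  small zero    _   _   = refl
  small (suc r) r≤n p∣r = contradiction (ℕ.≤-trans (∣⇒≤ p∣r) r≤n) (ℕ.<⇒≱ n<p)

-- Vanishing subsums of signed powers.

HasVanishingSubsum : ∀ {n} → Vector ℤ n → Set
HasVanishingSubsum {n} x = ∃[ I ] Nonempty {n} I × I ⊂ ⊤ × ∑[ I ] x ≡ 0ℤ

-- There are finitely many subsets, so the condition on a concrete cycle can be settled by
-- evaluation.
hasVanishingSubsum? : ∀ {n} (x : Vector ℤ n) → Dec (HasVanishingSubsum x)
hasVanishingSubsum? x =
  anySubset? λ I → nonempty? I ×-dec I ⊂? ⊤ ×-dec (∑[ I ] x ℤ.≟ 0ℤ)

◃-opposite : ∀ s n → (s ◃ n) ℤ.+ (Sign.opposite s ◃ n) ≡ 0ℤ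
◃-opposite Sign.+ zero    = refl
◃-opposite Sign.- zero    = refl
◃-opposite Sign.+ (suc n) = ℤ.+-inverseʳ (+ suc n)
◃-opposite Sign.- (suc n) = ℤ.+-inverseˡ (+ suc n)

≢⇒opposite : ∀ {s t : Sign} → t ≢ s → t ≡ Sign.opposite s
≢⇒opposite {Sign.+} {Sign.+} t≢s = contradiction refl t≢s
≢⇒opposite {Sign.+} {Sign.-} t≢s = refl
≢⇒opposite {Sign.-} {Sign.+} t≢s = refl
≢⇒opposite {Sign.-} {Sign.-} t≢s = contradiction refl t≢s

-- If all signs agreed, the sum would be four times a nonzero integer. So some sign differs from the
-- first one, and those two terms cancel.
equal-terms : ∀ c .{{_ : ℕ.NonZero c}} (ε : Vector Sign 4) (u : Vector ℕ 4) → (∀ i → u i ≡ c) →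
  ∑ (λ i → ε i ◃ u i) ≡ 0ℤ → HasVanishingSubsum (λ i → ε i ◃ u i)
equal-terms c ε u u≡c ∑≡0
  with ε 1F Sign.≟ ε 0F | ε 2F Sign.≟ ε 0F | ε 3F Sign.≟ ε 0F
... | no ε₁≢ε₀ | _ | _ rewrite u≡c 0F | u≡c 1F | ≢⇒opposite ε₁≢ε₀ =
  (inside ∷ inside ∷ outside ∷ outside ∷ []) , (0F , here) , (⊆⊤ , 2F , ∈⊤ , λ { (there (there ())) })
    , trans (cong (λ y → (ε 0F ◃ c) ℤ.+ y) (ℤ.+-identityʳ _)) (◃-opposite (ε 0F) c)
... | _ | no ε₂≢ε₀ | _ rewrite u≡c 0F | u≡c 2F | ≢⇒opposite ε₂≢ε₀ =
  (inside ∷ outside ∷ inside ∷ outside ∷ []) , (0F , here) , (⊆⊤ , 1F , ∈⊤ , λ { (there ()) })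
    , trans (cong (λ y → (ε 0F ◃ c) ℤ.+ y) (trans (ℤ.+-identityˡ _) (ℤ.+-identityʳ _))) (◃-opposite (ε 0F) c)
... | _ | _ | no ε₃≢ε₀ rewrite u≡c 0F | u≡c 3F | ≢⇒opposite ε₃≢ε₀ =
  (inside ∷ outside ∷ outside ∷ inside ∷ []) , (0F , here) , (⊆⊤ , 1F , ∈⊤ , λ { (there ()) })
    , trans (cong (λ y → (ε 0F ◃ c) ℤ.+ y) (trans (ℤ.+-identityˡ _) (trans (ℤ.+-identityˡ _) (ℤ.+-identityʳ _)))) (◃-opposite (ε 0F) c)
... | yes ε₁≡ε₀ | yes ε₂≡ε₀ | yes ε₃≡ε₀
  rewrite u≡c 0F | u≡c 1F | u≡c 2F | u≡c 3F | ε₁≡ε₀ | ε₂≡ε₀ | ε₃≡ε₀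
  = contradiction (ℤ.i*j≡0⇒i≡0∨j≡0 (+ 4) (trans (sym (4x (ε 0F ◃ c))) ∑≡0))
      λ { (inj₁ ()) ; (inj₂ x≡0) → ℕ.≢-nonZero⁻¹ c (trans (sym (ℤ.abs-◃ (ε 0F) c)) (cong ∣_∣ x≡0)) }
  where
  4x : ∀ x → x ℤ.+ (x ℤ.+ (x ℤ.+ (x ℤ.+ 0ℤ))) ≡ + 4 ℤ.* x
  4x = solve-∀

powers-vanishing-subsum : ∀ p → 4 < p → (ε : Vector Sign 4) (u k : Vector ℕ 4) → (∀ i → u i ≡ p ^ k i) →
  ∑ (λ i → ε i ◃ u i) ≡ 0ℤ → HasVanishingSubsum (λ i → ε i ◃ u i)
powers-vanishing-subsum p@(suc _) 4<p ε u k u≡ ∑≡0 =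
  -- `argmin` needs a default index; `0F` is harmless, as it occurs in the list anyway.
  from-least (argmin k 0F (allFin 4)) λ i → All.lookup (f[argmin]≤f[xs] {f = k} 0F (allFin 4)) (∈-allFin i)
  where
  from-least : ∀ i₀ → (∀ i → k i₀ ≤ k i) → HasVanishingSubsum (λ i → ε i ◃ u i)
  from-least i₀ m≤k with all? (λ i → k i ℕ.≟ k i₀)
  -- Here the lowest level is the whole index set, hence not a proper subset, and a cancelling pair
  -- is taken instead.
  ... | yes k≡m =
    equal-terms (p ^ k i₀) {{ℕ.m^n≢0 p (k i₀)}} ε u (λ i → trans (u≡ i) (cong (p ^_) (k≡m i))) ∑≡0
  -- The level contains `i₀` and misses `j`, so it is nonempty and proper.
  ... | no ¬k≡m =
    let m = k i₀
        j , kj≢m = ¬∀⟶∃¬ 4 _ (λ i → k i ℕ.≟ m) ¬k≡m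
    in level m k
      , (i₀ , lookup⇒[]= i₀ (level m k) (trans (lookup∘tabulate (λ i → does (k i ℕ.≟ m)) i₀) (dec-true (k i₀ ℕ.≟ m) refl)))
      , (⊆⊤ , j , ∈⊤ , λ j∈ → contradiction
          (trans (sym ([]=⇒lookup j∈)) (trans (lookup∘tabulate (λ i → does (k i ℕ.≟ m)) j) (dec-false (k j ℕ.≟ m) kj≢m))) λ ())
      , lowest-terms-vanish p m ε u k 4<p u≡ m≤k ∑≡0

-- Large primes, and explicit cycles for 2 and 3.

prime-cases : ∀ p → Prime p → (p ≡ 2 ⊎ p ≡ 3) ⊎ 4 < p
prime-cases 0 p-prime = contradiction p-prime ¬prime[0]
prime-cases 1 p-prime = contradiction p-prime ¬prime[1]
prime-cases 2 p-prime = inj₁ (inj₁ refl)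
prime-cases 3 p-prime = inj₁ (inj₂ refl)
prime-cases 4 p-prime = contradiction p-prime (composite⇒¬prime composite[4])
prime-cases (suc (suc (suc (suc (suc n))))) p-prime = inj₂ (ℕ.m≤m+n 5 n)

¬4-cycle : ∀ {p} P → 4 < p → (∀ j → elem P j ≡ p) → ¬ Admits4Cycle P
¬4-cycle {p} P 4<p elem≡p (ε , a , ∑≡0 , ∑[]≢0) =
  let I , ne , I⊂⊤ , ∑[I]≡0 = powers-vanishing-subsum p 4<p ε (λ i → monomial P (a i))
                                (proj₁ ∘ power) (proj₂ ∘ power) ∑≡0
  in ∑[]≢0 I ne I⊂⊤ ∑[I]≡0
  where
  power : ∀ i → ∃[ k ] monomial P (a i) ≡ p ^ k
  power i = product-of-powers (elem P) (a i) elem≡p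

4-cycle : ∀ P (ε : Vector Sign 4) (a : Vector (Vector ℕ (size P)) 4) →
  let x = λ i → ε i ◃ monomial P (a i) in ∑ x ≡ 0ℤ → ¬ HasVanishingSubsum x → Admits4Cycle P
4-cycle P ε a ∑≡0 ¬vanishing = ε , a , ∑≡0 , λ I ne I⊂⊤ ∑[I]≡0 → ¬vanishing (I , ne , I⊂⊤ , ∑[I]≡0)

4-cycle[2] : ∀ 2-prime → Admits4Cycle (singleton 2 2-prime)
4-cycle[2] 2-prime = 4-cycle (singleton 2 2-prime) ε a refl
  -- The decision procedure evaluates to `no`, which rules out every proper subsum at once.
  (from-no (hasVanishingSubsum? (λ i → ε i ◃ monomial (singleton 2 2-prime) (a i))))
  where
  ε : Vector Sign 4
  ε = λ { 0F → Sign.+ ; 1F → Sign.+ ; 2F → Sign.+ ; 3F → Sign.- }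
  a : Vector (Vector ℕ 1) 4
  a = λ { 0F _ → 0 ; 1F _ → 0 ; 2F _ → 1 ; 3F _ → 2 }

4-cycle[3] : ∀ 3-prime → Admits4Cycle (singleton 3 3-prime)
4-cycle[3] 3-prime = 4-cycle (singleton 3 3-prime) ε a refl
  (from-no (hasVanishingSubsum? (λ i → ε i ◃ monomial (singleton 3 3-prime) (a i))))
  where
  ε : Vector Sign 4
  ε = λ { 0F → Sign.+ ; 1F → Sign.+ ; 2F → Sign.+ ; 3F → Sign.- }
  a : Vector (Vector ℕ 1) 4
  a = λ { 0F _ → 0 ; 1F _ → 0 ; 2F _ → 0 ; 3F _ → 1 }

ℤ[1/]-4-cycle : ∀ P → Admits4Cycle P → RingAdmits4Cycle ℤ[1/ P ]
ℤ[1/]-4-cycle P cycle = P , ((λ {_} r → r) , (λ {_} r → r)) , cycle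

theorem1p4 : (p : ℕ) (p-prime : Prime p) → RingAdmits4Cycle ℤ[1/ singleton p p-prime ] ⇔ (p ≡ 2 ⊎ p ≡ 3)
theorem1p4 p p-prime = mk⇔ to from
  where
  to : RingAdmits4Cycle ℤ[1/ singleton p p-prime ] → p ≡ 2 ⊎ p ≡ 3
  to (P , R≐ , cycle) with prime-cases p p-prime
  ... | inj₁ p≡2∨3 = p≡2∨3
  -- `proj₂ R≐` includes `ℤ[1/ P ]` in `ℤ[1/ singleton p p-prime ]`, so every prime of `P` is `p`.
  ... | inj₂ 4<p   = contradiction cycle (¬4-cycle P 4<p (ℤ[1/]-elem≡ p-prime P (λ {x} → proj₂ R≐ {x})))

  from : p ≡ 2 ⊎ p ≡ 3 → RingAdmits4Cycle ℤ[1/ singleton p p-prime ]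
  from (inj₁ refl) = ℤ[1/]-4-cycle (singleton 2 p-prime) (4-cycle[2] p-prime)
  from (inj₂ refl) = ℤ[1/]-4-cycle (singleton 3 p-prime) (4-cycle[3] p-prime)
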